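{- There is a substitution basis for the class $\mathcal{E}$ of Kalmár elementary functions that consists of one binary operation only; that is, there exists a binary operation $h:\mathbb{N}^2\to\mathbb{N}$ such that $\langle h\rangle=\mathcal{E}$.
   Context: $\mathbb{N}$ is the set of non-negative integers. An ($r$-ary, $r\ge 1$) operation on $\mathbb{N}$ is a function $\mathbb{N}^r\to\mathbb{N}$. Truncated subtraction is $x \mathbin{\dot- } y:=\max(x-y,0)$. A set $S$ of operations on $\mathbb{N}$ is closed under substitution if, whenever $f\in S$ is $r$-ary and $g_1,\dots,g_r\in S$ are $n$-ary, the operation $\vec x\mapsto f(g_1(\vec x),\dots,g_r(\vec x))$ is in $S$. For a set $\mathcal{B}$ of operations on $\mathbb{N}$, $\langle\mathcal{B}\rangle$ denotes the closure under substitution of $\mathcal{B}\cup C\cup P$, where $C$ is the set of all constant operations on $\mathbb{N}$ (of every arity) and $P$ is the set of all projections $(x_1,\dots,x_n)\mapsto x_i$; $\langle h\rangle$ means $\langle\{h\}\rangle$. A set $\mathcal{B}$ is a substitution basis for a set $G$ of operations if $\langle\mathcal{B}\rangle=G$. The Kalmár elementary functions, forming the class $\mathcal{E}$, are the elements of the smallest set of operations on $\mathbb{N}$ that contains the constants, the projections, the addition, and the truncated subtraction, and that is closed under substitution, bounded summation ($(\vec x,y)\mapsto\sum_{z<y}f(\vec x,z)$), and bounded multiplication ($(\vec x,y)\mapsto\prod_{z<y}f(\vec x,z)$). -}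

module Defs where

open import Data.Fin.Base using (Fin)
open import Data.List.Base using (applyUpTo)
open import Data.Nat.Base using (ℕ; suc; _+_; _∸_)
open import Data.Nat.ListAction using (sum; product)
open import Data.Vec.Base using (Vec; []; _∷_; _∷ʳ_; init; last; lookup; tabulate)
open import Function.Base using (const)
open import Function.Bundles using (_⇔_)
open import Relation.Binary.PropositionalEquality using (_≗_)

Op : ℕ → Set
Op r = Vec ℕ r → ℕ

-- Only operations of positive arity are considered.

OpSet : Set₁
OpSet = ∀ {n} → Op (suc n) → Set

infix 4 _≐_

_≐_ : OpSet → OpSet → Set
S ≐ T = ∀ {n} (f : Op (suc n)) → S f ⇔ T f

-- Operations are functions taken up to pointwise equality, as in set theory.
-- In the absence of function extensionality, the sets of operations below
-- are made invariant under _≗_ explicitly.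

data ｛_｝ {n} (h : Op (suc n)) : OpSet where
  [_] : {g : Op (suc n)} → g ≗ h → ｛ h ｝ g

substitute : ∀ {r n} → Op r → (Fin r → Op n) → Op n
substitute f gs x⃗ = f (tabulate λ i → gs i x⃗)

addition : Op 2
addition (x ∷ y ∷ []) = x + y

truncatedSubtraction : Op 2
truncatedSubtraction (x ∷ y ∷ []) = x ∸ y

-- The bound y is the last argument; x⃗ may be empty.

boundedSum : ∀ {n} → Op (suc n) → Op (suc n)
boundedSum f x⃗y = sum (applyUpTo (λ z → f (init x⃗y ∷ʳ z)) (last x⃗y))

boundedProduct : ∀ {n} → Op (suc n) → Op (suc n)
boundedProduct f x⃗y = product (applyUpTo (λ z → f (init x⃗y ∷ʳ z)) (last x⃗y))

data ⟨_⟩ (B : OpSet) : OpSet where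
  base         : ∀ {n} {f : Op (suc n)} → B f → ⟨ B ⟩ f
  constant     : ∀ {n} (c : ℕ) → ⟨ B ⟩ {n} (const c)
  projection   : ∀ {n} (i : Fin (suc n)) → ⟨ B ⟩ {n} (λ x⃗ → lookup x⃗ i)
  substitution : ∀ {m n} {f : Op (suc m)} {gs : Fin (suc m) → Op (suc n)} →
                 ⟨ B ⟩ f → (∀ i → ⟨ B ⟩ (gs i)) → ⟨ B ⟩ (substitute f gs)
  respects     : ∀ {n} {f g : Op (suc n)} → f ≗ g → ⟨ B ⟩ f → ⟨ B ⟩ g

data KalmarElementary : OpSet where
  constant       : ∀ {n} (c : ℕ) → KalmarElementary {n} (const c)
  projection     : ∀ {n} (i : Fin (suc n)) →
                   KalmarElementary {n} (λ x⃗ → lookup x⃗ i)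
  plus           : KalmarElementary addition
  monus          : KalmarElementary truncatedSubtraction
  substitution   : ∀ {m n} {f : Op (suc m)} {gs : Fin (suc m) → Op (suc n)} →
                   KalmarElementary f → (∀ i → KalmarElementary (gs i)) →
                   KalmarElementary (substitute f gs)
  summation      : ∀ {n} {f : Op (suc n)} →
                   KalmarElementary f → KalmarElementary (boundedSum f)
  multiplication : ∀ {n} {f : Op (suc n)} →
                   KalmarElementary f → KalmarElementary (boundedProduct f)
  respects       : ∀ {n} {f g : Op (suc n)} →
                   f ≗ g → KalmarElementary f → KalmarElementary g

SubstitutionBasis : OpSet → OpSet → Set
SubstitutionBasis B G = ⟨ B ⟩ ≐ G

{-# OPTIONS --safe #-}

-- The operation h multiplexes, by its first argument, the successor, the
-- exponential 2^b, a universal machine run for a given number of steps, and a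
-- pairing function.
-- h is elementary: a step of the machine increases its state at most
-- polynomially, hence t steps at most doubly exponentially, and the iteration of
-- an elementary function under an elementary bound is elementary.
-- Conversely, every elementary operation is computed by a program of the machine
-- in time at most 2^(2^(…^x)), with a tower of fixed height and x the code of the
-- arguments. Towers are generated by h, and programs are constants.
module Submission where

open import Data.Empty using (⊥-elim)
open import Data.Fin.Base using (Fin; zero; suc; fromℕ; inject₁)
open import Data.Fin.Patterns using (0F; 1F; 2F; 3F; 4F)
open import Data.Fin.Relation.Unary.Top using (view; ‵fromℕ; ‵inject₁)
open import Data.List.Base as List using (List; []; _∷_; applyUpTo)
import Data.List.Properties as List
open import Data.Nat.Base
open import Data.Nat.GeneralisedArithmetic using (fold; fold-+)
open import Data.Nat.ListAction using (sum; product)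
open import Data.Nat.ListAction.Properties using (sum-++; product-++)
open import Data.Nat.Properties
open import Data.Nat.Tactic.RingSolver using (solve-∀)
open import Data.Product.Base using (Σ-syntax; ∃; ∃₂; _×_; _,_; proj₁; proj₂)
open import Data.Vec.Base using (Vec; []; _∷_; _∷ʳ_; init; last; lookup; tabulate)
open import Data.Vec.Properties using (init-∷ʳ; last-∷ʳ; tabulate∘lookup)
open import Function.Base using (_∘_; const; case_of_)
open import Function.Bundles using (mk⇔)
open import Relation.Binary.PropositionalEquality
open import Defs

private
  variable
    m n : ℕ
    f g k : Op n

-- Last entries and initial segments of vectors

lookup-fromℕ : (v : Vec ℕ (suc n)) → lookup v (fromℕ n) ≡ last v
lookup-fromℕ (x ∷ [])     = refl
lookup-fromℕ (x ∷ y ∷ v) = lookup-fromℕ (y ∷ v)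

lookup-inject₁ : (v : Vec ℕ (suc n)) (i : Fin n) → lookup v (inject₁ i) ≡ lookup (init v) i
lookup-inject₁ (x ∷ y ∷ v) zero    = refl
lookup-inject₁ (x ∷ y ∷ v) (suc i) = lookup-inject₁ (y ∷ v) i

lookup-∷ʳ-inject₁ : (v : Vec ℕ n) (x : ℕ) (i : Fin n) → lookup (v ∷ʳ x) (inject₁ i) ≡ lookup v i
lookup-∷ʳ-inject₁ v x i = trans (lookup-inject₁ (v ∷ʳ x) i) (cong (λ w → lookup w i) (init-∷ʳ x v))

lookup-∷ʳ-fromℕ : (v : Vec ℕ n) (x : ℕ) → lookup (v ∷ʳ x) (fromℕ n) ≡ x
lookup-∷ʳ-fromℕ v x = trans (lookup-fromℕ (v ∷ʳ x)) (last-∷ʳ x v)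

tabulate-∷ʳ : (f : Fin (suc n) → ℕ) → tabulate f ≡ tabulate (f ∘ inject₁) ∷ʳ f (fromℕ n)
tabulate-∷ʳ {n = zero}  f = refl
tabulate-∷ʳ {n = suc n} f = cong (f zero ∷_) (tabulate-∷ʳ (f ∘ suc))

-- Bounded sums and products of unary functions

sum< product< : ℕ → (ℕ → ℕ) → ℕ
sum<     n f = sum (applyUpTo f n)
product< n f = product (applyUpTo f n)

sum<-cong : ∀ n {f g} → f ≗ g → sum< n f ≡ sum< n g
sum<-cong zero    f≗g = refl
sum<-cong (suc n) f≗g = cong₂ _+_ (f≗g 0) (sum<-cong n (f≗g ∘ suc))

product<-cong : ∀ n {f g} → f ≗ g → product< n f ≡ product< n g
product<-cong zero    f≗g = refl
product<-cong (suc n) f≗g = cong₂ _*_ (f≗g 0) (product<-cong n (f≗g ∘ suc))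

sum<-const : ∀ n c → sum< n (const c) ≡ n * c
sum<-const zero    c = refl
sum<-const (suc n) c = cong (c +_) (sum<-const n c)

product<-const : ∀ n c → product< n (const c) ≡ c ^ n
product<-const zero    c = refl
product<-const (suc n) c = cong (c *_) (product<-const n c)

sum<-0 : ∀ n {f} → (∀ i → f i ≡ 0) → sum< n f ≡ 0
sum<-0 zero    f≗0 = refl
sum<-0 (suc n) f≗0 = cong₂ _+_ (f≗0 0) (sum<-0 n (f≗0 ∘ suc))

sum<-*ʳ : ∀ n f c → sum< n (λ i → f i * c) ≡ sum< n f * c
sum<-*ʳ zero    f c = refl
sum<-*ʳ (suc n) f c = trans (cong (f 0 * c +_) (sum<-*ʳ n (f ∘ suc) c))
                            (sym (*-distribʳ-+ c (f 0) (sum< n (f ∘ suc))))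

≤-sum< : ∀ {n i} f → i < n → f i ≤ sum< n f
≤-sum< {suc n} {zero}  f _         = m≤m+n (f 0) _
≤-sum< {suc n} {suc i} f (s≤s i<n) = m≤n⇒m≤o+n (f 0) (≤-sum< (f ∘ suc) i<n)

product<-1 : ∀ n {f} → (∀ i → i < n → f i ≡ 1) → product< n f ≡ 1
product<-1 zero    _   = refl
product<-1 (suc n) f≗1 = cong₂ _*_ (f≗1 0 z<s) (product<-1 n λ i i<n → f≗1 (suc i) (s<s i<n))

product<-≢0 : ∀ {n i} f → product< n f ≢ 0 → i < n → f i ≢ 0
product<-≢0 {suc n} {zero}  f p≢0 _         f0≡0 = p≢0 (cong (_* product< n (f ∘ suc)) f0≡0)
product<-≢0 {suc n} {suc i} f p≢0 (s≤s i<n) fi≡0 =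
  product<-≢0 (f ∘ suc) (λ p≡0 → p≢0 (trans (cong (f 0 *_) p≡0) (*-zeroʳ (f 0)))) i<n fi≡0

sum<-suc : ∀ n f → sum< (suc n) f ≡ sum< n f + f n
sum<-suc n f = begin
  sum (applyUpTo f (suc n))          ≡⟨ cong sum (List.applyUpTo-∷ʳ f n) ⟨
  sum (applyUpTo f n List.∷ʳ f n)    ≡⟨ sum-++ (applyUpTo f n) _ ⟩
  sum< n f + (f n + 0)               ≡⟨ cong (sum< n f +_) (+-identityʳ (f n)) ⟩
  sum< n f + f n                     ∎
  where open ≡-Reasoning

product<-suc : ∀ n f → product< (suc n) f ≡ product< n f * f n
product<-suc n f = begin
  product (applyUpTo f (suc n))       ≡⟨ cong product (List.applyUpTo-∷ʳ f n) ⟨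
  product (applyUpTo f n List.∷ʳ f n) ≡⟨ product-++ (applyUpTo f n) _ ⟩
  product< n f * (f n * 1)            ≡⟨ cong (product< n f *_) (*-identityʳ (f n)) ⟩
  product< n f * f n                  ∎
  where open ≡-Reasoning

-- A sum over the indicator of an initial segment counts its length. This turns the search for the
-- largest number with a monotone property into a bounded sum; `quot` and `sqrt` are evaluated in
-- this way.
sum<-threshold : ∀ {n s} f → (∀ i → i < s → f i ≡ 1) → (∀ i → s ≤ i → f i ≡ 0) →
                 s ≤ n → sum< n f ≡ s
sum<-threshold {n}     {zero}  f _  f0 _         = sum<-0 n λ i → f0 i z≤n
sum<-threshold {suc n} {suc s} f f1 f0 (s≤s s≤n) =
  cong₂ _+_ (f1 0 z<s)
    (sum<-threshold (f ∘ suc) (λ i i<s → f1 (suc i) (s<s i<s)) (λ i s≤i → f0 (suc i) (s≤s s≤i)) s≤n)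

-- Characteristic functions, division and digit expansions

χ≤ χ≡ : ℕ → ℕ → ℕ
χ≤ a b = 1 ∸ (a ∸ b)
χ≡ a b = 1 ∸ ((a ∸ b) + (b ∸ a))

χ≤-yes : ∀ {a b} → a ≤ b → χ≤ a b ≡ 1
χ≤-yes a≤b = cong (1 ∸_) (m≤n⇒m∸n≡0 a≤b)

χ≤-no : ∀ {a b} → b < a → χ≤ a b ≡ 0
χ≤-no b<a = m≤n⇒m∸n≡0 (m<n⇒0<n∸m b<a)

χ≡-refl : ∀ a → χ≡ a a ≡ 1
χ≡-refl a rewrite n∸n≡0 a = refl

χ≡-≢0 : ∀ a b → χ≡ a b ≢ 0 → a ≡ b
χ≡-≢0 zero    zero    _  = refl
χ≡-≢0 zero    (suc b) ≢0 = ⊥-elim (≢0 (0∸n≡0 b))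
χ≡-≢0 (suc a) zero    ≢0 = ⊥-elim (≢0 (0∸n≡0 (a + 0)))
χ≡-≢0 (suc a) (suc b) ≢0 = cong suc (χ≡-≢0 a b ≢0)

-- The summation range `n` suffices because a quotient by a positive number is at most `n`. For `m`
-- = 0 all terms count and `quot n 0` is `n`.
quot rem : ℕ → ℕ → ℕ
quot n m = sum< n λ i → χ≤ (suc i * m) n
rem  n m = n ∸ quot n m * m

digit : ℕ → ℕ → ℕ → ℕ
digit b i q = rem (quot q (b ^ i)) b

quot-unique : ∀ {n m} q r → r < m → n ≡ r + q * m → quot n m ≡ q
quot-unique {n} {m@(suc _)} q r r<m refl = sum<-threshold _
  (λ i i<q → χ≤-yes (m≤n⇒m≤o+n r (*-monoˡ-≤ m i<q)))
  (λ i q≤i → χ≤-no (≤-trans (+-monoˡ-< (q * m) r<m) (*-monoˡ-≤ m (s≤s q≤i))))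
  (m≤n⇒m≤o+n r (m≤m*n q m))

rem-unique : ∀ {n m} q r → r < m → n ≡ r + q * m → rem n m ≡ r
rem-unique {n} {m} q r r<m n≡ rewrite quot-unique q r r<m n≡ | n≡ = m+n∸n≡m r (q * m)

digit-unique : ∀ {b i q} lo d hi → lo < b ^ i → d < b → q ≡ lo + (d + hi * b) * b ^ i → digit b i q ≡ d
digit-unique lo d hi lo< d< q≡ = rem-unique hi d d< (quot-unique (d + hi * _) lo lo< q≡)

-- The least significant digit comes first.
fromDigits : ℕ → (ℕ → ℕ) → ℕ → ℕ
fromDigits b f zero    = 0
fromDigits b f (suc t) = f 0 + fromDigits b (f ∘ suc) t * b

fromDigits-< : ∀ b f t → (∀ i → i < t → f i < b) → fromDigits b f t < b ^ t
fromDigits-< b f zero    _  = z<s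
fromDigits-< b f (suc t) f< = begin-strict
  f 0 + q * b <⟨ +-monoˡ-< (q * b) (f< 0 z<s) ⟩
  suc q * b   ≤⟨ *-monoˡ-≤ b (fromDigits-< b (f ∘ suc) t λ i i<t → f< (suc i) (s<s i<t)) ⟩
  b ^ t * b   ≡⟨ *-comm (b ^ t) b ⟩
  b ^ suc t   ∎
  where open ≤-Reasoning
        q = fromDigits b (f ∘ suc) t

split-identity : ∀ f₀ lo d hi p b →
                 f₀ + (lo + (d + hi * b) * p) * b ≡ (f₀ + lo * b) + (d + hi * b) * (b * p)
split-identity = solve-∀

-- Removing the lowest digit reduces position `suc i` to position `i` of the shifted sequence. The
-- decomposition has the shape that `digit-unique` asks for.
fromDigits-split : ∀ {b t i} f → (∀ i → i < t → f i < b) → i < t →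
                   ∃₂ λ lo hi → lo < b ^ i × fromDigits b f t ≡ lo + (f i + hi * b) * b ^ i
fromDigits-split {b} {suc t} {zero}  f f< _ =
  0 , fromDigits b (f ∘ suc) t , z<s , sym (*-identityʳ _)
fromDigits-split {b} {suc t} {suc i} f f< (s≤s i<t)
  with lo , hi , lo< , eq ← fromDigits-split {b} {t} {i} (f ∘ suc) (λ i i<t → f< (suc i) (s<s i<t)) i<t =
  f 0 + lo * b , hi ,
  (begin-strict
    f 0 + lo * b <⟨ +-monoˡ-< (lo * b) (f< 0 z<s) ⟩
    suc lo * b   ≤⟨ *-monoˡ-≤ b lo< ⟩
    b ^ i * b    ≡⟨ *-comm (b ^ i) b ⟩
    b ^ suc i    ∎) ,
  trans (cong (λ q → f 0 + q * b) eq) (split-identity (f 0) lo (f (suc i)) hi (b ^ i) b)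
  where open ≤-Reasoning

digit-fromDigits : ∀ {b t i} f → (∀ i → i < t → f i < b) → i < t → digit b i (fromDigits b f t) ≡ f i
digit-fromDigits {i = i} f f< i<t with lo , hi , lo< , eq ← fromDigits-split f f< i<t =
  digit-unique {i = i} lo (f i) hi lo< (f< _ i<t) eq

-- Iteration through codes of traces

isTrace : (ℕ → ℕ) → ℕ → ℕ → ℕ → ℕ → ℕ
isTrace g s t b q =
  χ≡ (digit b 0 q) s * product< t λ i → χ≡ (digit b (suc i) q) (g (digit b i q))

-- A nonzero product has no zero factor, so digit 0 is `s` and every later digit up to `t` is `g` of
-- the one before; induction on the position does the rest.
isTrace-sound : ∀ g s t b q → isTrace g s t b q ≢ 0 → ∀ i → i ≤ t → digit b i q ≡ fold s g i
isTrace-sound g s t b q tr zero    _   =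
  χ≡-≢0 _ _ λ e → tr (cong (_* product< t λ i → χ≡ (digit b (suc i) q) (g (digit b i q))) e)
isTrace-sound g s t b q tr (suc i) i<t = trans
  (χ≡-≢0 _ _ (product<-≢0 _ (λ e → tr (trans (cong (χ≡ (digit b 0 q) s *_) e) (*-zeroʳ (χ≡ (digit b 0 q) s)))) i<t))
  (cong g (isTrace-sound g s t b q tr i (<⇒≤ i<t)))

isTrace-complete : ∀ g s t b → (∀ i → i ≤ t → fold s g i < b) →
                   isTrace g s t b (fromDigits b (fold s g) (suc t)) ≡ 1
isTrace-complete g s t b fold< = cong₂ _*_
  (trans (cong (λ d → χ≡ d s) (dig z<s)) (χ≡-refl s))
  (product<-1 t λ i i<t → trans (cong₂ χ≡ (dig (s<s i<t)) (cong g (dig (m<n⇒m<1+n i<t)))) (χ≡-refl (fold s g (suc i))))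
  where
  dig : ∀ {i} → i < suc t → digit b i (fromDigits b (fold s g) (suc t)) ≡ fold s g i
  dig = digit-fromDigits (fold s g) λ i i≤t → fold< i (≤-pred i≤t)

-- All traces q have the same digit gᵗ s at position t, which is therefore the
-- quotient of the sum of these digits by the number of traces.
fold-quot : ∀ g s t b → (∀ i → i ≤ t → fold s g i < b) →
            quot (sum< (b ^ suc t) λ q → isTrace g s t b q * digit b t q)
                 (sum< (b ^ suc t) λ q → isTrace g s t b q) ≡ fold s g t
fold-quot g s t b fold< = quot-unique (fold s g t) 0 traces>0 (begin
  sum< (b ^ suc t) (λ q → isTrace g s t b q * digit b t q) ≡⟨ sum<-cong (b ^ suc t) same ⟩
  sum< (b ^ suc t) (λ q → isTrace g s t b q * fold s g t)  ≡⟨ sum<-*ʳ (b ^ suc t) _ _ ⟩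
  traces * fold s g t                                      ≡⟨ *-comm traces _ ⟩
  fold s g t * traces                                      ∎)
  where
  open ≡-Reasoning
  traces = sum< (b ^ suc t) λ q → isTrace g s t b q
  same : ∀ q → isTrace g s t b q * digit b t q ≡ isTrace g s t b q * fold s g t
  same q with isTrace g s t b q in eq
  ... | zero    = refl
  ... | suc c   = cong (suc c *_) (isTrace-sound g s t b q (λ e → case trans (sym eq) e of λ ()) t ≤-refl)
  traces>0 : 0 < traces
  -- The number whose `suc t` digits are the iterates lies below `b ^ suc t` and is itself a trace,
  -- so the divisor is positive.
  traces>0 = ≤-trans (≤-reflexive (sym (isTrace-complete g s t b fold<)))
    (≤-sum< (isTrace g s t b) (fromDigits-< b (fold s g) (suc t) λ i i≤t → fold< i (≤-pred i≤t)))

-- Closure properties of the elementary operations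

Elementary₁ : (ℕ → ℕ) → Set
Elementary₁ F = KalmarElementary {0} λ v → F (lookup v 0F)

Elementary₂ : (ℕ → ℕ → ℕ) → Set
Elementary₂ F = KalmarElementary {1} λ v → F (lookup v 0F) (lookup v 1F)

Elementary₃ : (ℕ → ℕ → ℕ → ℕ) → Set
Elementary₃ F = KalmarElementary {2} λ v → F (lookup v 0F) (lookup v 1F) (lookup v 2F)

app₁ : ∀ F → Elementary₁ F → KalmarElementary {n} f → KalmarElementary {n} λ v → F (f v)
app₁ {f = f} F F-el f-el = substitution {gs = λ _ → f} F-el λ _ → f-el

app₂ : ∀ F → Elementary₂ F → KalmarElementary {n} f → KalmarElementary {n} g →
       KalmarElementary {n} λ v → F (f v) (g v)
app₂ {f = f} {g} F F-el f-el g-el =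
  substitution {gs = λ { 0F → f ; 1F → g }} F-el λ { 0F → f-el ; 1F → g-el }

app₃ : ∀ F → Elementary₃ F → KalmarElementary {n} f → KalmarElementary {n} g → KalmarElementary {n} k →
       KalmarElementary {n} λ v → F (f v) (g v) (k v)
app₃ {f = f} {g} {k} F F-el f-el g-el k-el =
  substitution {gs = λ { 0F → f ; 1F → g ; 2F → k }} F-el λ { 0F → f-el ; 1F → g-el ; 2F → k-el }

var : (i : Fin (suc n)) → KalmarElementary {n} λ v → lookup v i
var = projection

con : (c : ℕ) → KalmarElementary {n} (const c)
con = constant

_⊕_ : KalmarElementary {n} f → KalmarElementary {n} g → KalmarElementary {n} λ v → f v + g v
_⊕_ = app₂ _+_ (respects (λ { (_ ∷ _ ∷ []) → refl }) plus)

_⊖_ : KalmarElementary {n} f → KalmarElementary {n} g → KalmarElementary {n} λ v → f v ∸ g v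
_⊖_ = app₂ _∸_ (respects (λ { (_ ∷ _ ∷ []) → refl }) monus)

infixl 6 _⊕_ _⊖_

-- The last argument is where bounded sums and products take their bound; this puts a computed bound
-- there.
sub-∷ʳ : {f : Op (suc (suc n))} → KalmarElementary f → KalmarElementary {n} g →
         KalmarElementary λ v → f (v ∷ʳ g v)
sub-∷ʳ {n} {g} {f} f-el g-el = respects
  (λ v → cong f (tabulate∘lookup (v ∷ʳ g v)))
  (substitution {gs = λ i v → lookup (v ∷ʳ g v) i} f-el component)
  where
  component : (i : Fin (suc (suc n))) → KalmarElementary λ v → lookup (v ∷ʳ g v) i
  component i with view i
  ... | ‵fromℕ     = respects (λ v → sym (lookup-∷ʳ-fromℕ v (g v))) g-el
  ... | ‵inject₁ j = respects (λ v → sym (lookup-∷ʳ-inject₁ v (g v) j)) (var j)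

sub-last∷init : {f : Op (suc n)} → KalmarElementary f → KalmarElementary λ v → f (last v ∷ init v)
sub-last∷init {n} {f} f-el = respects
  (λ v → cong f (tabulate∘lookup (last v ∷ init v)))
  (substitution {gs = λ i v → lookup (last v ∷ init v) i} f-el λ
    { zero    → respects lookup-fromℕ (var (fromℕ n))
    ; (suc i) → respects (λ v → lookup-inject₁ v i) (var (inject₁ i)) })

-- The bound variable comes first, as for de Bruijn indices, not last as in boundedSum.
Σ< : {g : Op (suc (suc n))} → KalmarElementary {n} f → KalmarElementary g →
     KalmarElementary λ v → sum< (f v) λ i → g (i ∷ v)
Σ< {n} {f} {g} f-el g-el = respects eq (sub-∷ʳ (summation (sub-last∷init g-el)) f-el)
  where
  eq : ∀ v → boundedSum (λ w → g (last w ∷ init w)) (v ∷ʳ f v) ≡ sum< (f v) λ i → g (i ∷ v)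
  eq v rewrite init-∷ʳ (f v) v | last-∷ʳ (f v) v =
    sum<-cong (f v) λ i → cong₂ (λ x w → g (x ∷ w)) (last-∷ʳ i v) (init-∷ʳ i v)

Π< : {g : Op (suc (suc n))} → KalmarElementary {n} f → KalmarElementary g →
     KalmarElementary λ v → product< (f v) λ i → g (i ∷ v)
Π< {n} {f} {g} f-el g-el = respects eq (sub-∷ʳ (multiplication (sub-last∷init g-el)) f-el)
  where
  eq : ∀ v → boundedProduct (λ w → g (last w ∷ init w)) (v ∷ʳ f v) ≡ product< (f v) λ i → g (i ∷ v)
  eq v rewrite init-∷ʳ (f v) v | last-∷ʳ (f v) v =
    product<-cong (f v) λ i → cong₂ (λ x w → g (x ∷ w)) (last-∷ʳ i v) (init-∷ʳ i v)

_⊛_ : KalmarElementary {n} f → KalmarElementary {n} g → KalmarElementary {n} λ v → f v * g v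
_⊛_ = app₂ _*_ (respects (λ v → sum<-const (lookup v 0F) (lookup v 1F)) (Σ< (var 0F) (var 2F)))

_⊛^_ : KalmarElementary {n} f → KalmarElementary {n} g → KalmarElementary {n} λ v → f v ^ g v
_⊛^_ = app₂ _^_ (respects (λ v → product<-const (lookup v 1F) (lookup v 0F)) (Π< (var 1F) (var 1F)))

infixl 7 _⊛_
infixr 8 _⊛^_

χ≤-el : KalmarElementary {n} f → KalmarElementary {n} g → KalmarElementary {n} λ v → χ≤ (f v) (g v)
χ≤-el f-el g-el = con 1 ⊖ (f-el ⊖ g-el)

χ≡-el : KalmarElementary {n} f → KalmarElementary {n} g → KalmarElementary {n} λ v → χ≡ (f v) (g v)
χ≡-el f-el g-el = con 1 ⊖ (f-el ⊖ g-el ⊕ (g-el ⊖ f-el))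

quot-el : KalmarElementary {n} f → KalmarElementary {n} g → KalmarElementary {n} λ v → quot (f v) (g v)
quot-el = app₂ quot (Σ< (var 0F) (χ≤-el ((con 1 ⊕ var 0F) ⊛ var 2F) (var 1F)))

digit-el : KalmarElementary {n} f → KalmarElementary {n} g → KalmarElementary {n} k →
           KalmarElementary {n} λ v → digit (f v) (g v) (k v)
digit-el = app₃ digit (q ⊖ quot-el q (var 0F) ⊛ var 0F)
  where q = quot-el (var 2F) (var 0F ⊛^ var 1F)

-- With the bound `B s t` as the base of the digits, every iterate up to `t` fits into one digit and
-- all relevant codes lie below `B s t ^ suc t`. The quotient of sums in `fold-quot` is then an
-- elementary expression.
fold-elementary : ∀ F B → Elementary₁ F → Elementary₂ B →
                  (∀ s t i → i ≤ t → fold s F i < B s t) → Elementary₂ λ s t → fold s F t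
fold-elementary F B F-el B-el fold< = respects
  (λ v → let s = lookup v 0F ; t = lookup v 1F in fold-quot F s t (B s t) (fold< s t))
  (quot-el (Σ< #codes (trace ⊛ digit-el (B′ 1F 2F) (var 2F) (var 0F))) (Σ< #codes trace))
  where
  B′ : (i j : Fin (suc n)) → KalmarElementary λ v → B (lookup v i) (lookup v j)
  B′ i j = app₂ B B-el (var i) (var j)
  #codes = B′ {n = 1} 0F 1F ⊛^ (con 1 ⊕ var 1F)
  -- Under the sum the variables are the code, `s` and `t`; under the product the position comes in
  -- front of these three.
  trace  = χ≡-el (digit-el (B′ 1F 2F) (con 0) (var 0F)) (var 1F) ⊛
           Π< {n = 2} (var 2F)
             (χ≡-el (digit-el (B′ 2F 3F) (con 1 ⊕ var 0F) (var 1F))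
                    (app₁ F F-el (digit-el (B′ 2F 3F) (var 0F) (var 1F))))

-- A pairing function and its inverses

opaque
  -- Since y ≤ x + y, the value lies between the square of x + y and the next square. Hence its
  -- integer square root is x + y, and the excess over that square is y.
  pair : ℕ → ℕ → ℕ
  pair x y = (x + y) * (x + y) + y

  sqrt π₁ π₂ : ℕ → ℕ
  sqrt n = sum< n λ i → χ≤ (suc i * suc i) n
  π₂   n = n ∸ sqrt n * sqrt n
  π₁   n = sqrt n ∸ π₂ n

  sqrt-unique : ∀ {n} s → s * s ≤ n → n < suc s * suc s → sqrt n ≡ s
  sqrt-unique s s²≤n n<[1+s]² = sum<-threshold _
    (λ i i<s → χ≤-yes (≤-trans (*-mono-≤ i<s i<s) s²≤n))
    (λ i s≤i → χ≤-no (<-≤-trans n<[1+s]² (*-mono-≤ (s≤s s≤i) (s≤s s≤i))))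
    (≤-trans (s≤s² s) s²≤n)
    where
    s≤s² : ∀ s → s ≤ s * s
    s≤s² zero      = z≤n
    s≤s² s@(suc _) = m≤m*n s s

  sqrt-pair : ∀ x y → sqrt (pair x y) ≡ x + y
  sqrt-pair x y = sqrt-unique (x + y) (m≤m+n _ y)
    (≤-trans (m≤m+n _ (x + (x + y))) (≤-reflexive (square x y)))
    where
    square : ∀ x y → suc ((x + y) * (x + y) + y) + (x + (x + y)) ≡ suc (x + y) * suc (x + y)
    square = solve-∀

  π₂-pair : ∀ x y → π₂ (pair x y) ≡ y
  π₂-pair x y rewrite sqrt-pair x y = m+n∸m≡n ((x + y) * (x + y)) y

  π₁-pair : ∀ x y → π₁ (pair x y) ≡ x
  π₁-pair x y rewrite π₂-pair x y | sqrt-pair x y = m+n∸n≡m x y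

  π₂-≤ : ∀ n → π₂ n ≤ n
  π₂-≤ n = m∸n≤m n (sqrt n * sqrt n)

  sqrt-≤ : ∀ n → sqrt n ≤ n
  sqrt-≤ n = ≤-trans (sum<-≤ n (λ i → m∸n≤m 1 (suc i * suc i ∸ n))) (≤-reflexive (trans (sum<-const n 1) (*-identityʳ n)))
    where
    sum<-≤ : ∀ n {f c} → (∀ i → f i ≤ c) → sum< n f ≤ sum< n (const c)
    sum<-≤ zero    f≤c = z≤n
    sum<-≤ (suc n) f≤c = +-mono-≤ (f≤c 0) (sum<-≤ n (f≤c ∘ suc))

  π₁-≤ : ∀ n → π₁ n ≤ n
  π₁-≤ n = ≤-trans (m∸n≤m (sqrt n) (π₂ n)) (sqrt-≤ n)

  π₁-0 : π₁ 0 ≡ 0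
  π₁-0 = refl

  pair-≤ : ∀ x y → pair x y ≤ (x + y) * (x + y) + y
  pair-≤ x y = ≤-refl

  pair-≥ˡ : ∀ x y → x ≤ pair x y
  pair-≥ˡ zero        y = z≤n
  pair-≥ˡ x@(suc _) y = ≤-trans (≤-trans (m≤m+n x y) (m≤m*n (x + y) (x + y))) (m≤m+n _ y)

  pair-≥ʳ : ∀ x y → y ≤ pair x y
  pair-≥ʳ x y = m≤n+m y _

  pair-mono-≤ : ∀ {x x′ y y′} → x ≤ x′ → y ≤ y′ → pair x y ≤ pair x′ y′
  pair-mono-≤ x≤x′ y≤y′ = +-mono-≤ (*-mono-≤ (+-mono-≤ x≤x′ y≤y′) (+-mono-≤ x≤x′ y≤y′)) y≤y′

  pair-el : KalmarElementary {n} f → KalmarElementary {n} g → KalmarElementary {n} λ v → pair (f v) (g v)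
  pair-el f-el g-el = (f-el ⊕ g-el) ⊛ (f-el ⊕ g-el) ⊕ g-el

  sqrt-el : KalmarElementary {n} f → KalmarElementary {n} λ v → sqrt (f v)
  sqrt-el = app₁ sqrt (Σ< (var 0F) (χ≤-el ((con 1 ⊕ var 0F) ⊛ (con 1 ⊕ var 0F)) (var 1F)))

  π₂-el : KalmarElementary {n} f → KalmarElementary {n} λ v → π₂ (f v)
  π₂-el f-el = f-el ⊖ sqrt-el f-el ⊛ sqrt-el f-el

  π₁-el : KalmarElementary {n} f → KalmarElementary {n} λ v → π₁ (f v)
  π₁-el f-el = sqrt-el f-el ⊖ π₂-el f-el

-- Case distinction and terms of polynomial growth

if0 : ℕ → ℕ → ℕ → ℕ
if0 zero    a b = a
if0 (suc _) a b = b

if0-arith : ∀ c a b → (1 ∸ c) * a + (1 ∸ (1 ∸ c)) * b ≡ if0 c a b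
if0-arith zero    a b = trans (+-identityʳ _) (*-identityˡ a)
if0-arith (suc c) a b rewrite 0∸n≡0 c = *-identityˡ b

if0-el : KalmarElementary {n} f → KalmarElementary {n} g → KalmarElementary {n} k →
         KalmarElementary {n} λ v → if0 (f v) (g v) (k v)
if0-el {f = f} {g} {k} c a b = respects (λ v → if0-arith (f v) (g v) (k v)) ((con 1 ⊖ c) ⊛ a ⊕ (con 1 ⊖ (con 1 ⊖ c)) ⊛ b)

-- Unlike elementary operations, these terms grow at most polynomially.
data Term (n : ℕ) : Set where
  `                    : Fin n → Term n
  #                    : ℕ → Term n
  _`+_ _`*_ _`∸_ ⟪_,_⟫ : Term n → Term n → Term n
  `π₁ `π₂              : Term n → Term n
  `if0                 : Term n → Term n → Term n → Term n

infixl 6 _`+_ _`∸_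
infixl 7 _`*_

⟦_⟧ : Term n → Op n
⟦ ` i ⟧        v = lookup v i
⟦ # c ⟧        v = c
⟦ a `+ b ⟧     v = ⟦ a ⟧ v + ⟦ b ⟧ v
⟦ a `* b ⟧     v = ⟦ a ⟧ v * ⟦ b ⟧ v
⟦ a `∸ b ⟧     v = ⟦ a ⟧ v ∸ ⟦ b ⟧ v
⟦ ⟪ a , b ⟫ ⟧  v = pair (⟦ a ⟧ v) (⟦ b ⟧ v)
⟦ `π₁ a ⟧      v = π₁ (⟦ a ⟧ v)
⟦ `π₂ a ⟧      v = π₂ (⟦ a ⟧ v)
⟦ `if0 c a b ⟧ v = if0 (⟦ c ⟧ v) (⟦ a ⟧ v) (⟦ b ⟧ v)

⟦⟧-elementary : (t : Term (suc n)) → KalmarElementary ⟦ t ⟧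
⟦⟧-elementary (` i)        = var i
⟦⟧-elementary (# c)        = con c
⟦⟧-elementary (a `+ b)     = ⟦⟧-elementary a ⊕ ⟦⟧-elementary b
⟦⟧-elementary (a `* b)     = ⟦⟧-elementary a ⊛ ⟦⟧-elementary b
⟦⟧-elementary (a `∸ b)     = ⟦⟧-elementary a ⊖ ⟦⟧-elementary b
⟦⟧-elementary ⟪ a , b ⟫    = pair-el (⟦⟧-elementary a) (⟦⟧-elementary b)
⟦⟧-elementary (`π₁ a)      = π₁-el (⟦⟧-elementary a)
⟦⟧-elementary (`π₂ a)      = π₂-el (⟦⟧-elementary a)
⟦⟧-elementary (`if0 c a b) = if0-el (⟦⟧-elementary c) (⟦⟧-elementary a) (⟦⟧-elementary b)

-- An exponent d such that 2 + the value is at most (2 + s) ^ d whenever all variables are at most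
-- s. The offset 2 lets a product of bounds dominate a sum as well, and makes the base at least 2,
-- so that a constant c is covered by 2 + c < 2 ^ (2 + c).
degree : Term n → ℕ
degree (` i)        = 1
degree (# c)        = 2 + c
degree (a `+ b)     = degree a + degree b
degree (a `* b)     = degree a + degree b
degree (a `∸ b)     = degree a
degree ⟪ a , b ⟫    = (degree a + degree b) + (degree a + degree b)
degree (`π₁ a)      = degree a
degree (`π₂ a)      = degree a
degree (`if0 c a b) = degree a + degree b

n<2^n : ∀ n → n < 2 ^ n
n<2^n zero    = z<s
n<2^n (suc n) = ≤-trans (+-mono-≤ (m^n>0 2 n) (n<2^n n)) (≤-reflexive (cong (2 ^ n +_) (sym (+-identityʳ _))))

2++≤ : ∀ a b → 2 + (a + b) ≤ (2 + a) * (2 + b)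
2++≤ a b = ≤-trans (m≤m+n _ (2 + (a + b + a * b))) (≤-reflexive (lemma a b))
  where
  lemma : ∀ a b → 2 + (a + b) + (2 + (a + b + a * b)) ≡ (2 + a) * (2 + b)
  lemma = solve-∀

2+*≤ : ∀ a b → 2 + a * b ≤ (2 + a) * (2 + b)
2+*≤ a b = ≤-trans (m≤m+n _ (2 + (a + b + (a + b)))) (≤-reflexive (lemma a b))
  where
  lemma : ∀ a b → 2 + a * b + (2 + (a + b + (a + b))) ≡ (2 + a) * (2 + b)
  lemma = solve-∀

2+pair≤ : ∀ a b → 2 + pair a b ≤ ((2 + a) * (2 + b)) * ((2 + a) * (2 + b))
2+pair≤ a b = begin
  2 + pair a b                     ≤⟨ +-monoʳ-≤ 2 (pair-≤ a b) ⟩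
  2 + (s * s + b)                  ≤⟨ +-monoʳ-≤ 2 (+-monoʳ-≤ (s * s) (m≤n+m b a)) ⟩
  2 + (s * s + s)                  ≤⟨ m≤m+n _ (2 + 3 * s) ⟩
  2 + (s * s + s) + (2 + 3 * s)    ≡⟨ lemma s ⟩
  (2 + s) * (2 + s)                ≤⟨ *-mono-≤ (2++≤ a b) (2++≤ a b) ⟩
  ((2 + a) * (2 + b)) * ((2 + a) * (2 + b)) ∎
  where
  open ≤-Reasoning
  s = a + b
  lemma : ∀ s → 2 + (s * s + s) + (2 + 3 * s) ≡ (2 + s) * (2 + s)
  lemma = solve-∀

⟦⟧-bound : (t : Term n) → ∀ v s → (∀ i → lookup v i ≤ s) → 2 + ⟦ t ⟧ v ≤ (2 + s) ^ degree t
⟦⟧-bound t v s v≤s = go t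
  where
  open ≤-Reasoning
  mul : ∀ {p q i j} → p ≤ (2 + s) ^ i → q ≤ (2 + s) ^ j → p * q ≤ (2 + s) ^ (i + j)
  mul {i = i} {j} p≤ q≤ = ≤-trans (*-mono-≤ p≤ q≤) (≤-reflexive (sym (^-distribˡ-+-* (2 + s) i j)))
  go : ∀ t → 2 + ⟦ t ⟧ v ≤ (2 + s) ^ degree t
  product-bound : ∀ a b → (2 + ⟦ a ⟧ v) * (2 + ⟦ b ⟧ v) ≤ (2 + s) ^ (degree a + degree b)
  product-bound a b = mul {i = degree a} (go a) (go b)
  go (` i)        = ≤-trans (+-monoʳ-≤ 2 (v≤s i)) (≤-reflexive (sym (*-identityʳ (2 + s))))
  go (# c)        = ≤-trans (<⇒≤ (n<2^n (2 + c))) (^-monoˡ-≤ (2 + c) (m≤m+n 2 s))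
  go (a `+ b)     = ≤-trans (2++≤ (⟦ a ⟧ v) (⟦ b ⟧ v)) (product-bound a b)
  go (a `* b)     = ≤-trans (2+*≤ (⟦ a ⟧ v) (⟦ b ⟧ v)) (product-bound a b)
  go (a `∸ b)     = ≤-trans (+-monoʳ-≤ 2 (m∸n≤m _ (⟦ b ⟧ v))) (go a)
  go ⟪ a , b ⟫    = ≤-trans (2+pair≤ _ _)
                      (mul {i = degree a + degree b} (product-bound a b) (product-bound a b))
  go (`π₁ a)      = ≤-trans (+-monoʳ-≤ 2 (π₁-≤ _)) (go a)
  go (`π₂ a)      = ≤-trans (+-monoʳ-≤ 2 (π₂-≤ _)) (go a)
  go (`if0 c a b) = ≤-trans (≤-trans (+-monoʳ-≤ 2 (if0-≤ (⟦ c ⟧ v))) (2++≤ _ _)) (product-bound a b)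
    where
    if0-≤ : ∀ c {a b} → if0 c a b ≤ a + b
    if0-≤ zero    = m≤m+n _ _
    if0-≤ (suc _) = m≤n+m _ _

-- A universal machine

cmd : ℕ → ℕ → ℕ → ℕ
cmd tag c d = pair tag (pair c d)

infixr 5 _▸_
_▸_ : ℕ → ℕ → ℕ
_▸_ = pair

-- A state consists of a stack of pending commands and the current value. Compound commands push
-- their parts onto the stack.
state : ℕ → ℕ → ℕ
state = pair

-- The variables of a transition are the tag and the two arguments of the
-- current command, the remaining commands, and the current value; entry k is
-- the transition of the commands with tag k. Since π₁ 0 = 0, the empty list 0 of
-- commands acts as the command halt.
transitions : List (Term 5)
transitions =
  -- 0: halt
  ⟪ # 0 , val ⟫ ∷
  -- 1–6: constant, π₁, π₂, +, *, ∸
  ⟪ rest , arg₁ ⟫ ∷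
  ⟪ rest , `π₁ val ⟫ ∷
  ⟪ rest , `π₂ val ⟫ ∷
  ⟪ rest , `π₁ val `+ `π₂ val ⟫ ∷
  ⟪ rest , `π₁ val `* `π₂ val ⟫ ∷
  ⟪ rest , `π₁ val `∸ `π₂ val ⟫ ∷
  -- 7: composition
  ⟪ ⟪ arg₁ , ⟪ arg₂ , rest ⟫ ⟫ , val ⟫ ∷
  -- 8–10: pairing of the results of two commands, and its two later stages
  ⟪ ⟪ arg₁ , ⟪ `cmd 9 arg₂ val , rest ⟫ ⟫ , val ⟫ ∷
  ⟪ ⟪ arg₁ , ⟪ `cmd 10 val (# 0) , rest ⟫ ⟫ , arg₂ ⟫ ∷
  ⟪ rest , ⟪ arg₁ , val ⟫ ⟫ ∷
  -- 11, 12: iteration, and the loop with a counter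
  ⟪ ⟪ `cmd 12 arg₁ (`π₁ val) , rest ⟫ , `π₂ val ⟫ ∷
  `if0 arg₂ ⟪ rest , val ⟫ ⟪ ⟪ arg₁ , ⟪ `cmd 12 arg₁ (arg₂ `∸ # 1) , rest ⟫ ⟫ , val ⟫ ∷
  []
  where
  arg₁ arg₂ rest val : Term 5
  arg₁ = ` 1F
  arg₂ = ` 2F
  rest = ` 3F
  val  = ` 4F
  `cmd : ℕ → Term 5 → Term 5 → Term 5
  `cmd t c d = ⟪ # t , ⟪ c , d ⟫ ⟫

-- The test asks whether the tag is at most `k`. Since the earlier tests have excluded smaller tags,
-- it singles out the tag `k`. Tags beyond the table yield 0.
select : ℕ → List (Term 5) → Term 5
select k []       = # 0
select k (t ∷ ts) = `if0 (` 0F `∸ # k) t (select (suc k) ts)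

stepTerm : Term 5
stepTerm = select 0 transitions

transition : Term 5 → ℕ → ℕ
transition t s = ⟦ t ⟧
  (π₁ (π₁ (π₁ s)) ∷ π₁ (π₂ (π₁ (π₁ s))) ∷ π₂ (π₂ (π₁ (π₁ s))) ∷ π₂ (π₁ s) ∷ π₂ s ∷ [])

transition-cmd : ∀ t tag c d K v →
                 transition t (state (cmd tag c d ▸ K) v) ≡ ⟦ t ⟧ (tag ∷ c ∷ d ∷ K ∷ v ∷ [])
transition-cmd t tag c d K v
  rewrite π₁-pair (cmd tag c d ▸ K) v | π₂-pair (cmd tag c d ▸ K) v
        | π₁-pair (cmd tag c d) K | π₂-pair (cmd tag c d) K
        | π₁-pair tag (pair c d) | π₂-pair tag (pair c d)
        | π₁-pair c d | π₂-pair c d = refl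

transition-elementary : ∀ t → Elementary₁ (transition t)
transition-elementary t = substitution
  {gs = λ { 0F v → π₁ (π₁ (π₁ (lookup v 0F))) ; 1F v → π₁ (π₂ (π₁ (π₁ (lookup v 0F))))
          ; 2F v → π₂ (π₂ (π₁ (π₁ (lookup v 0F)))) ; 3F v → π₂ (π₁ (lookup v 0F)) ; 4F v → π₂ (lookup v 0F) }}
  (⟦⟧-elementary t)
  λ { 0F → π₁-el (π₁-el (π₁-el (var 0F))) ; 1F → π₁-el (π₂-el (π₁-el (π₁-el (var 0F))))
    ; 2F → π₂-el (π₂-el (π₁-el (π₁-el (var 0F)))) ; 3F → π₂-el (π₁-el (var 0F)) ; 4F → π₂-el (var 0F) }

transition-bound : ∀ t s → 2 + transition t s ≤ (2 + s) ^ suc (degree t)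
transition-bound t s = ≤-trans
  (⟦⟧-bound t _ s λ
    { 0F → ≤-trans (π₁-≤ _) (≤-trans (π₁-≤ _) (π₁-≤ s))
    ; 1F → ≤-trans (π₁-≤ _) (≤-trans (π₂-≤ _) (≤-trans (π₁-≤ _) (π₁-≤ s)))
    ; 2F → ≤-trans (π₂-≤ _) (≤-trans (π₂-≤ _) (≤-trans (π₁-≤ _) (π₁-≤ s)))
    ; 3F → ≤-trans (π₂-≤ _) (π₁-≤ s)
    ; 4F → π₂-≤ s })
  -- The successor makes the exponent d positive, which the monotonicity of `d ^ i` in `i` relies
  -- on.
  (^-monoʳ-≤ (2 + s) (n≤1+n (degree t)))

-- Each step raises 2 + the state to at most the power d, so the exponents multiply to `d ^ i`.
fold-transition-bound : ∀ t s i → 2 + fold s (transition t) i ≤ (2 + s) ^ (suc (degree t) ^ i)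
fold-transition-bound t s zero    = ≤-reflexive (sym (*-identityʳ (2 + s)))
fold-transition-bound t s (suc i) = begin
  2 + transition t (fold s (transition t) i) ≤⟨ transition-bound t _ ⟩
  (2 + fold s (transition t) i) ^ d          ≤⟨ ^-monoˡ-≤ d (fold-transition-bound t s i) ⟩
  ((2 + s) ^ (d ^ i)) ^ d                    ≡⟨ ^-*-assoc (2 + s) (d ^ i) d ⟩
  (2 + s) ^ (d ^ i * d)                      ≡⟨ cong ((2 + s) ^_) (*-comm (d ^ i) d) ⟩
  (2 + s) ^ (d ^ suc i)                      ∎
  where
  open ≤-Reasoning
  d = suc (degree t)

fold-transition-elementary : ∀ t → Elementary₂ λ s i → fold s (transition t) i
fold-transition-elementary t =
  fold-elementary (transition t) (λ s i → (2 + s) ^ (d ^ i)) (transition-elementary t)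
    ((con 2 ⊕ var 0F) ⊛^ (con d ⊛^ var 1F))
    λ s i j j≤i → begin-strict
      fold s (transition t) j     <⟨ m<n+m _ z<s ⟩
      2 + fold s (transition t) j ≤⟨ fold-transition-bound t s j ⟩
      (2 + s) ^ (d ^ j)           ≤⟨ ^-monoʳ-≤ (2 + s) (^-monoʳ-≤ d j≤i) ⟩
      (2 + s) ^ (d ^ i)           ∎
  where
  open ≤-Reasoning
  d = suc (degree t)

opaque
  step : ℕ → ℕ
  step = transition stepTerm

  step-cmd : ∀ tag c d K v → step (state (cmd tag c d ▸ K) v) ≡ ⟦ stepTerm ⟧ (tag ∷ c ∷ d ∷ K ∷ v ∷ [])
  step-cmd = transition-cmd stepTerm

  -- A final state is a fixed point, so a run may be given more steps than it takes.
  step-halt : ∀ v → step (state 0 v) ≡ state 0 v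
  step-halt v rewrite π₁-pair 0 v | π₂-pair 0 v | π₁-0 | π₁-0 = refl

  run-elementary : Elementary₂ λ s t → fold s step t
  run-elementary = fold-transition-elementary stepTerm

-- Domination by towers of exponentials

tower : ℕ → ℕ → ℕ
tower k m = fold m (2 ^_) k

tower-monoʳ-≤ : ∀ k {m m′} → m ≤ m′ → tower k m ≤ tower k m′
tower-monoʳ-≤ zero    m≤m′ = m≤m′
tower-monoʳ-≤ (suc k) m≤m′ = ^-monoʳ-≤ 2 (tower-monoʳ-≤ k m≤m′)

k+m≤tower : ∀ k m → k + m ≤ tower k m
k+m≤tower zero    m = ≤-refl
k+m≤tower (suc k) m = ≤-trans (s≤s (k+m≤tower k m)) (n<2^n (tower k m))

tower-+ : ∀ k l m → tower (k + l) m ≡ tower k (tower l m)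
tower-+ k l m = fold-+ m (2 ^_) k

private
  variable
    A B : Set
    e u w x y : A → ℕ

infix 4 _≼_

-- The height of the tower is the same for all inputs. Domination in this sense is transitive, as
-- heights add, and is preserved by sums, products and powers.
_≼_ : (A → ℕ) → (A → ℕ) → Set
f ≼ e = ∃ λ k → ∀ a → f a ≤ tower k (e a)

≼-≤ : (∀ a → x a ≤ y a) → y ≼ e → x ≼ e
≼-≤ x≤y (k , y≤) = k , λ a → ≤-trans (x≤y a) (y≤ a)

≼-refl : e ≼ e
≼-refl = 0 , λ _ → ≤-refl

≼-trans : w ≼ u → u ≼ e → w ≼ e
≼-trans {w = w} {u} {e} (k , w≤) (l , u≤) = k + l , λ a → begin
  w a                 ≤⟨ w≤ a ⟩
  tower k (u a)       ≤⟨ tower-monoʳ-≤ k (u≤ a) ⟩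
  tower k (tower l _) ≡⟨ tower-+ k l (e a) ⟨
  tower (k + l) _     ∎
  where open ≤-Reasoning

≼-const : ∀ c → const c ≼ e
≼-const {e = e} c = c , λ a → ≤-trans (m≤m+n c (e a)) (k+m≤tower c (e a))

n+n≤2^n : ∀ n → n + n ≤ 2 ^ n
n+n≤2^n zero    = z≤n
n+n≤2^n (suc n) = ≤-trans (+-mono-≤ (n<2^n n) (n<2^n n)) (≤-reflexive (cong (2 ^ n +_) (sym (+-identityʳ _))))

-- Both summands are lifted to the common height `k + l`; one further exponential absorbs the
-- doubling.
≼-+ : x ≼ e → y ≼ e → (λ a → x a + y a) ≼ e
≼-+ {x = x} {e} {y} (k , x≤) (l , y≤) = suc (k + l) , λ a → begin
  x a + y a                                   ≤⟨ +-mono-≤ (x≤′ a) (y≤′ a) ⟩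
  tower (k + l) (e a) + tower (k + l) (e a)   ≤⟨ n+n≤2^n (tower (k + l) (e a)) ⟩
  tower (suc (k + l)) (e a)                   ∎
  where
  open ≤-Reasoning
  x≤′ : ∀ a → x a ≤ tower (k + l) (e a)
  x≤′ a = ≤-trans (x≤ a) (≤-trans (tower-monoʳ-≤ k (≤-trans (m≤n+m (e a) l) (k+m≤tower l (e a))))
                                  (≤-reflexive (sym (tower-+ k l (e a)))))
  y≤′ : ∀ a → y a ≤ tower (k + l) (e a)
  y≤′ a = ≤-trans (y≤ a) (≤-trans (m≤n+m _ k)
            (≤-trans (k+m≤tower k _) (≤-reflexive (sym (tower-+ k l (e a))))))

≼-2^ : x ≼ e → (λ a → 2 ^ x a) ≼ e
≼-2^ (k , x≤) = suc k , λ a → ^-monoʳ-≤ 2 (x≤ a)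

≼-* : x ≼ e → y ≼ e → (λ a → x a * y a) ≼ e
≼-* {x = x} {y = y} x≼ y≼ = ≼-≤
  (λ a → ≤-trans (*-mono-≤ (<⇒≤ (n<2^n (x a))) (<⇒≤ (n<2^n (y a))))
                 (≤-reflexive (sym (^-distribˡ-+-* 2 (x a) (y a)))))
  (≼-2^ (≼-+ x≼ y≼))

≼-^ : x ≼ e → y ≼ e → (λ a → x a ^ y a) ≼ e
≼-^ {x = x} {y = y} x≼ y≼ = ≼-≤
  (λ a → ≤-trans (^-monoˡ-≤ (y a) (<⇒≤ (n<2^n (x a)))) (≤-reflexive (^-*-assoc 2 (x a) (y a))))
  (≼-2^ (≼-* x≼ y≼))

≼-pair : x ≼ e → y ≼ e → (λ a → pair (x a) (y a)) ≼ e
≼-pair x≼ y≼ = ≼-≤ (λ a → pair-≤ _ _) (≼-+ (≼-* (≼-+ x≼ y≼) (≼-+ x≼ y≼)) y≼)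

-- Runs of the machine and programs with bounded cost

infix 4 _⟶[_]_

record _⟶[_]_ (s t s′ : ℕ) : Set where
  constructor reaches
  field
    fold≡ : fold s step t ≡ s′

open _⟶[_]_

⟶-trans : ∀ {s s′ s″ t t′} → s ⟶[ t ] s′ → s′ ⟶[ t′ ] s″ → s ⟶[ t′ + t ] s″
⟶-trans {s} {t = t} {t′} (reaches p) (reaches q) =
  reaches (trans (fold-+ s step t′) (trans (cong (λ z → fold z step t′) p) q))

infixr 4 _then_

_then_ : ∀ {s s′ s″ t} → step s ≡ s′ → s′ ⟶[ t ] s″ → s ⟶[ t + 1 ] s″
p then q = ⟶-trans (reaches p) q

halted : ∀ v t → state 0 v ⟶[ t ] state 0 v
halted v zero    = reaches refl
halted v (suc t) = ⟶-trans {t′ = 1} (halted v t) (reaches (step-halt v))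

-- One program serves the whole family of inputs. Quantifying over the remaining commands `K` makes
-- programs composable. The bound on the value is kept besides that on the time because a subsequent
-- program has its time bounded in terms of this value.
record Computation {A : Set} (e w : A → ℕ) : Set where
  field
    program : ℕ
    time    : A → ℕ
    runs    : ∀ a K → state (program ▸ K) (e a) ⟶[ time a ] state K (w a)
    time-≼  : time ≼ e
    value-≼ : w ≼ e


open Computation

reindex : (r : B → A) → Computation e w → Computation (e ∘ r) (w ∘ r)
reindex r C = record
  { program = program C ; time = time C ∘ r ; runs = runs C ∘ r
  ; time-≼  = let k , ≤k = time-≼ C in k , ≤k ∘ r
  ; value-≼ = let k , ≤k = value-≼ C in k , ≤k ∘ r }

transport : e ≗ u → w ≗ x → Computation e w → Computation u x
transport {u = u} {w} {x} e≗u w≗x C = record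
  { program = program C ; time = time C
  ; runs    = λ a K → subst₂ (λ p q → state (program C ▸ K) p ⟶[ time C a ] state K q) (e≗u a) (w≗x a) (runs C a K)
  ; time-≼  = let k , ≤k = time-≼ C in k , λ a → subst (λ p → _ ≤ tower k p) (e≗u a) (≤k a)
  ; value-≼ = let k , ≤k = value-≼ C in k , λ a → subst₂ (λ p q → q ≤ tower k p) (e≗u a) (w≗x a) (≤k a) }

primitive-step : ∀ tag c → (∀ a K → step (state (cmd tag c 0 ▸ K) (e a)) ≡ state K (w a)) → w ≼ e → Computation e w
primitive-step tag c runs w≼e = record
  { program = cmd tag c 0 ; time = const 1 ; runs = λ a K → reaches (runs a K) ; time-≼ = ≼-const 1 ; value-≼ = w≼e }

constC : ∀ c → Computation e (const c)
constC {e = e} c = primitive-step 1 c (λ a K → step-cmd 1 c 0 K (e a)) (≼-const c)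

π₁C : Computation (λ a → pair (x a) (y a)) x
π₁C {x = x} {y} = primitive-step 2 0
  (λ a K → trans (step-cmd 2 0 0 K _) (cong (state K) (π₁-pair (x a) (y a))))
  (≼-≤ (λ a → pair-≥ˡ (x a) (y a)) ≼-refl)

π₂C : Computation (λ a → pair (x a) (y a)) y
π₂C {x = x} {y} = primitive-step 3 0
  (λ a K → trans (step-cmd 3 0 0 K _) (cong (state K) (π₂-pair (x a) (y a))))
  (≼-≤ (λ a → pair-≥ʳ (x a) (y a)) ≼-refl)

infixl 5 _⨾_

_⨾_ : Computation e u → Computation u w → Computation e w
C ⨾ D = record
  { program = cmd 7 (program C) (program D)
  ; time    = λ a → (time D a + time C a) + 1
  ; runs    = λ a K → step-cmd 7 (program C) (program D) K _ then
                      ⟶-trans (runs C a (program D ▸ K)) (runs D a K)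
  -- `D` starts from the intermediate value, so its time bound passes through the bound on that
  -- value.
  ; time-≼  = ≼-+ (≼-+ (≼-trans (time-≼ D) (value-≼ C)) (time-≼ C)) (≼-const 1)
  ; value-≼ = ≼-trans (value-≼ D) (value-≼ C) }

-- The input has to survive the first program. Command 8 stores it inside a pending command 9, which
-- later restores it and stores the first result inside a command 10; the latter forms the pair.
pairC : Computation e x → Computation e y → Computation e (λ a → pair (x a) (y a))
pairC {e = e} {x} {y} C D = record
  { program = cmd 8 (program C) (program D)
  ; time    = λ a → (((1 + time D a) + 1) + time C a) + 1
  ; runs    = λ a K → step-cmd 8 (program C) (program D) K (e a) then
      ⟶-trans (runs C a (cmd 9 (program D) (e a) ▸ K))
        (step-cmd 9 (program D) (e a) K (x a) then
          ⟶-trans (runs D a (cmd 10 (x a) 0 ▸ K))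
            (reaches (step-cmd 10 (x a) 0 K (y a))))
  ; time-≼  = ≼-+ (≼-+ (≼-+ (≼-+ (≼-const 1) (time-≼ D)) (≼-const 1)) (time-≼ C)) (≼-const 1)
  ; value-≼ = ≼-pair (value-≼ C) (value-≼ D) }

binary : ∀ {w} tag → (∀ a K → step (state (cmd tag 0 0 ▸ K) (pair (x a) (y a))) ≡ state K (w a)) →
         w ≼ (λ a → pair (x a) (y a)) →
         Computation e x → Computation e y → Computation e w
binary tag runs w≼ C D = pairC C D ⨾ primitive-step tag 0 runs w≼

addC : Computation e x → Computation e y → Computation e (λ a → x a + y a)
addC {x = x} {y} = binary 4
  (λ a K → trans (step-cmd 4 0 0 K _) (cong₂ (λ p q → state K (p + q)) (π₁-pair (x a) (y a)) (π₂-pair (x a) (y a))))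
  (≼-+ (value-≼ π₁C) (value-≼ π₂C))

mulC : Computation e x → Computation e y → Computation e (λ a → x a * y a)
mulC {x = x} {y} = binary 5
  (λ a K → trans (step-cmd 5 0 0 K _) (cong₂ (λ p q → state K (p * q)) (π₁-pair (x a) (y a)) (π₂-pair (x a) (y a))))
  (≼-* (value-≼ π₁C) (value-≼ π₂C))

monusC : Computation e x → Computation e y → Computation e (λ a → x a ∸ y a)
monusC {x = x} {y} = binary 6
  (λ a K → trans (step-cmd 6 0 0 K _) (cong₂ (λ p q → state K (p ∸ q)) (π₁-pair (x a) (y a)) (π₂-pair (x a) (y a))))
  (≼-≤ (λ a → m∸n≤m (x a) (y a)) (value-≼ π₁C))

-- Each round costs one step besides its body, and leaving the loop costs one more.
loopTime : (ℕ → ℕ) → ℕ → ℕ → ℕ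
loopTime t i zero    = 1
loopTime t i (suc n) = (loopTime t (suc i) n + t i) + 1

loopTime-≤ : ∀ t i n {b} → (∀ j → j < i + n → t j ≤ b) → loopTime t i n ≤ suc (n * suc b)
loopTime-≤ t i zero    t≤b = ≤-refl
loopTime-≤ t i (suc n) {b} t≤b = begin
  (loopTime t (suc i) n + t i) + 1 ≤⟨ +-monoˡ-≤ 1 (+-mono-≤
                                        (loopTime-≤ t (suc i) n λ j j< → t≤b j (subst (j <_) (sym (+-suc i n)) j<))
                                        (t≤b i (m<m+n i z<s))) ⟩
  (suc (n * suc b) + b) + 1        ≡⟨ rearrange (n * suc b) b ⟩
  suc (suc n * suc b)              ∎
  where
  open ≤-Reasoning
  rearrange : ∀ p b → (suc p + b) + 1 ≡ suc (suc b + p)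
  rearrange = solve-∀

loop-runs : ∀ c (σ t : ℕ → ℕ) → (∀ i K → state (c ▸ K) (σ i) ⟶[ t i ] state K (σ (suc i))) →
            ∀ i n K → state (cmd 12 c n ▸ K) (σ i) ⟶[ loopTime t i n ] state K (σ (i + n))
loop-runs c σ t body i zero    K rewrite +-identityʳ i = reaches (step-cmd 12 c 0 K (σ i))
loop-runs c σ t body i (suc n) K rewrite +-suc i n =
  step-cmd 12 c (suc n) K (σ i) then
  ⟶-trans (body i (cmd 12 c n ▸ K)) (loop-runs c σ t body (suc i) n K)

-- Composing the value bound of the body `N a` times would give towers whose height depends on the
-- input. The bound `G` on all intermediate values, given in advance, avoids this: every round then
-- takes time at most one tower of fixed height over `G a`.
iterC : ∀ (σ : A → ℕ → ℕ) (N G : A → ℕ) → G ≼ e → (∀ a i → i ≤ N a → σ a i ≤ G a) →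
        Computation {A × ℕ} (λ (a , i) → σ a i) (λ (a , i) → σ a (suc i)) →
        Computation e (λ a → pair (N a) (σ a 0)) → Computation e (λ a → σ a (N a))
iterC {e = e} σ N G G≼e σ≤G C D = record
  { program = cmd 7 (program D) (cmd 11 (program C) 0)
  ; time    = λ a → ((loopTime (λ i → time C (a , i)) 0 (N a) + 1) + time D a) + 1
  ; runs    = λ a K → step-cmd 7 (program D) _ K (e a) then
      ⟶-trans (runs D a (cmd 11 (program C) 0 ▸ K))
        (trans (step-cmd 11 (program C) 0 K _)
               (cong₂ (λ n v → state (cmd 12 (program C) n ▸ K) v) (π₁-pair (N a) (σ a 0)) (π₂-pair (N a) (σ a 0))) then
         loop-runs (program C) (σ a) (λ i → time C (a , i)) (λ i → runs C (a , i)) 0 (N a) K)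
  ; time-≼  = ≼-+ (≼-+ (≼-+ loop-≼ (≼-const 1)) (time-≼ D)) (≼-const 1)
  ; value-≼ = ≼-≤ (λ a → σ≤G a (N a) ≤-refl) G≼e }
  where
  height = proj₁ (time-≼ C)
  N≼e : N ≼ e
  N≼e = ≼-≤ (λ a → pair-≥ˡ (N a) (σ a 0)) (value-≼ D)
  loop-≼ : (λ a → loopTime (λ i → time C (a , i)) 0 (N a)) ≼ e
  loop-≼ = ≼-≤
    (λ a → loopTime-≤ (λ i → time C (a , i)) 0 (N a) {tower height (G a)}
       λ j j<N → ≤-trans (proj₂ (time-≼ C) (a , j)) (tower-monoʳ-≤ height (σ≤G a j (<⇒≤ j<N))))
    (≼-+ (≼-const 1) (≼-* N≼e (≼-+ (≼-const 1) (≼-trans (height , λ _ → ≤-refl) G≼e))))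

-- Programs for the elementary operations

-- The last entry is outermost, so that appending the summation variable to the parameters is a
-- single pairing.
enc : Vec ℕ n → ℕ
enc {zero}  v = 0
enc {suc n} v = pair (enc (init v)) (last v)

enc-∷ʳ : (v : Vec ℕ n) (z : ℕ) → enc (v ∷ʳ z) ≡ pair (enc v) z
enc-∷ʳ v z = cong₂ (λ w y → pair (enc w) y) (init-∷ʳ z v) (last-∷ʳ z v)

enc-tabulate : (gs : Fin (suc n) → ℕ) → enc (tabulate gs) ≡ pair (enc (tabulate (gs ∘ inject₁))) (gs (fromℕ n))
enc-tabulate gs = trans (cong enc (tabulate-∷ʳ gs)) (enc-∷ʳ (tabulate (gs ∘ inject₁)) _)

Computable : Op n → Set
Computable f = Computation enc f

lookupC : (i : Fin n) → Computable λ v → lookup v i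
lookupC i with view i
... | ‵fromℕ     = transport (λ _ → refl) (λ v → sym (lookup-fromℕ v)) π₂C
... | ‵inject₁ j = transport (λ _ → refl) (λ v → sym (lookup-inject₁ v j)) (π₁C ⨾ reindex init (lookupC j))

tabulateC : {gs : Fin m → A → ℕ} → (∀ i → Computation e (gs i)) →
            Computation e λ a → enc (tabulate λ i → gs i a)
tabulateC {zero}           Cs = constC 0
tabulateC {suc m} {gs = gs} Cs = transport (λ _ → refl)
  (λ a → sym (enc-tabulate λ i → gs i a))
  (pairC (tabulateC (Cs ∘ inject₁)) (Cs (fromℕ m)))

substituteC : {gs : Fin m → Op n} → Computable f → (∀ i → Computable (gs i)) → Computable (substitute f gs)
substituteC {gs = gs} C Cs = tabulateC Cs ⨾ reindex (λ v → tabulate λ i → gs i v) C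

-- Sums and products are treated at once: the bound on ∙ is shared by + and *,
-- and keeps y iterations of ∙ at most exponential in y.
module _ (_∙_ : ℕ → ℕ → ℕ) (∙-bound : ∀ a b → 2 + a ∙ b ≤ (2 + a) * (2 + b))
         (∙C : ∀ {A : Set} {e x y : A → ℕ} → Computation e x → Computation e y → Computation e (λ a → x a ∙ y a))
         where

  -- The loop carries the code of the parameters, the counter and the partial result. All values of
  -- `f` that occur are below one tower `bound v`, so the partial results stay below a constant
  -- times a power of 2 + `bound v`, and `iterC` applies.
  accumulateC : {f : Op (suc n)} (S : Vec ℕ n → ℕ → ℕ) (ε : ℕ) → (∀ v → S v 0 ≡ ε) →
                (∀ v i → S v (suc i) ≡ S v i ∙ f (v ∷ʳ i)) →
                Computable f → Computable λ v → S (init v) (last v)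
  accumulateC {n} {f} S ε S-zero S-suc C = transport {e = enc} (λ _ → refl) (λ _ → refl)
    (iterC σ last (λ v → pair (enc v) ((2 + ε) * (2 + bound v) ^ last v))
           (≼-pair ≼-refl (≼-* (≼-const (2 + ε)) (≼-^ (≼-+ (≼-const 2) (height , λ _ → ≤-refl)) last-≼)))
           (λ v i i≤ → pair-mono-≤ (pair-mono-≤ ≤-refl i≤) (S-≤ v i i≤))
           body start
     ⨾ π₂C)
    where
    height = proj₁ (value-≼ C)
    bound : Vec ℕ (suc n) → ℕ
    bound v = tower height (enc v)
    last-≼ : last ≼ enc
    last-≼ = ≼-≤ (λ v → pair-≥ʳ (enc (init v)) (last v)) ≼-refl
    σ : Vec ℕ (suc n) → ℕ → ℕ
    σ v i = pair (pair (enc (init v)) i) (S (init v) i)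
    f-≤ : ∀ v i → i ≤ last v → f (init v ∷ʳ i) ≤ bound v
    f-≤ v i i≤ = ≤-trans (proj₂ (value-≼ C) (init v ∷ʳ i))
      (tower-monoʳ-≤ height (≤-trans (≤-reflexive (enc-∷ʳ (init v) i)) (pair-mono-≤ ≤-refl i≤)))
    2+S-≤ : ∀ v i → i ≤ last v → 2 + S (init v) i ≤ (2 + ε) * (2 + bound v) ^ i
    2+S-≤ v zero    _  rewrite S-zero (init v) = ≤-reflexive (sym (*-identityʳ (2 + ε)))
    2+S-≤ v (suc i) i< rewrite S-suc (init v) i = begin
      2 + S (init v) i ∙ f (init v ∷ʳ i)               ≤⟨ ∙-bound _ _ ⟩
      (2 + S (init v) i) * (2 + f (init v ∷ʳ i))       ≤⟨ *-mono-≤ (2+S-≤ v i (<⇒≤ i<)) (+-monoʳ-≤ 2 (f-≤ v i (<⇒≤ i<))) ⟩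
      (2 + ε) * (2 + bound v) ^ i * (2 + bound v)      ≡⟨ *-assoc (2 + ε) ((2 + bound v) ^ i) _ ⟩
      (2 + ε) * ((2 + bound v) ^ i * (2 + bound v))    ≡⟨ cong ((2 + ε) *_) (*-comm ((2 + bound v) ^ i) _) ⟩
      (2 + ε) * (2 + bound v) ^ suc i                  ∎
      where open ≤-Reasoning
    S-≤ : ∀ v i → i ≤ last v → S (init v) i ≤ (2 + ε) * (2 + bound v) ^ last v
    S-≤ v i i≤ = ≤-trans (m≤n+m _ 2)
      (≤-trans (2+S-≤ v i i≤) (*-monoʳ-≤ (2 + ε) (^-monoʳ-≤ (2 + bound v) i≤)))
    start : Computation enc λ v → pair (last v) (σ v 0)
    start = transport (λ _ → refl) (λ v → cong (λ s → pair (last v) (pair (pair (enc (init v)) 0) s)) (sym (S-zero (init v))))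
      (pairC π₂C (pairC (pairC π₁C (constC 0)) (constC ε)))
    body : Computation {Vec ℕ (suc n) × ℕ} (λ (v , i) → σ v i) (λ (v , i) → σ v (suc i))
    body = transport (λ _ → refl) (λ (v , i) → cong (pair (pair (enc (init v)) (suc i))) (sym (S-suc (init v) i)))
      (pairC (pairC (π₁C ⨾ π₁C) (addC (constC 1) (π₁C ⨾ π₂C)))
             -- The first component of the loop state is the code of `init v ∷ʳ i`, to which the
             -- program of `f` applies directly.
             (∙C π₂C (π₁C ⨾ transport (λ (v , i) → enc-∷ʳ (init v) i) (λ _ → refl) (reindex (λ (v , i) → init v ∷ʳ i) C))))

sumC : {f : Op (suc n)} → Computable f → Computable (boundedSum f)
sumC {f = f} = accumulateC _+_ 2++≤ addC (λ v y → sum< y λ z → f (v ∷ʳ z)) 0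
  (λ _ → refl) (λ v i → sum<-suc i _)

productC : {f : Op (suc n)} → Computable f → Computable (boundedProduct f)
productC {f = f} = accumulateC _*_ 2+*≤ mulC (λ v y → product< y λ z → f (v ∷ʳ z)) 1
  (λ _ → refl) (λ v i → product<-suc i _)

elementary⇒computable : {f : Op (suc n)} → KalmarElementary f → Computable f
elementary⇒computable (constant c)        = constC c
elementary⇒computable (projection i)      = lookupC i
elementary⇒computable plus                =
  transport (λ _ → refl) (λ { (_ ∷ _ ∷ []) → refl }) (addC (lookupC 0F) (lookupC 1F))
elementary⇒computable monus               =
  transport (λ _ → refl) (λ { (_ ∷ _ ∷ []) → refl }) (monusC (lookupC 0F) (lookupC 1F))
elementary⇒computable (substitution f gs) =
  substituteC (elementary⇒computable f) λ i → elementary⇒computable (gs i)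
elementary⇒computable (summation f)       = sumC (elementary⇒computable f)
elementary⇒computable (multiplication f)  = productC (elementary⇒computable f)
elementary⇒computable (respects f≗g f)    = transport (λ _ → refl) f≗g (elementary⇒computable f)

-- The basis

-- The first argument selects the mode. All values from 3 on mean pairing, and the shift by 3 leaves
-- the first component of the pair arbitrary. In mode 2, start state and number of steps are packed
-- into `b`, which keeps the operation binary.
h : Op 2
h (a ∷ b ∷ []) =
  if0 a       (suc b)
  (if0 (a ∸ 1) (2 ^ b)
  (if0 (a ∸ 2) (π₂ (fold (π₁ b) step (π₂ b)))
  (pair (a ∸ 3) b)))

h-elementary : KalmarElementary h
h-elementary = respects (λ { (_ ∷ _ ∷ []) → refl })
  (if0-el (var 0F)         (con 1 ⊕ var 1F)
  (if0-el (var 0F ⊖ con 1) (con 2 ⊛^ var 1F)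
  (if0-el (var 0F ⊖ con 2) (π₂-el (app₂ (λ s t → fold s step t) run-elementary (π₁-el (var 1F)) (π₂-el (var 1F))))
  (pair-el (var 0F ⊖ con 3) (var 1F)))))

generated⇒elementary : {f : Op (suc n)} → ⟨ ｛ h ｝ ⟩ f → KalmarElementary f
generated⇒elementary (base [ f≗h ])      = respects (λ v → sym (f≗h v)) h-elementary
generated⇒elementary (constant c)        = constant c
generated⇒elementary (projection i)      = projection i
generated⇒elementary (substitution f gs) = substitution (generated⇒elementary f) λ i → generated⇒elementary (gs i)
generated⇒elementary (respects f≗g f)    = respects f≗g (generated⇒elementary f)

-- Operations generated by `h`

Generated : Op (suc n) → Set
Generated f = ⟨ ｛ h ｝ ⟩ f

h-gen : {f g : Op (suc n)} → Generated f → Generated g → Generated λ v → h (f v ∷ g v ∷ [])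
h-gen {f = f} {g} f-gen g-gen =
  substitution {gs = λ { 0F → f ; 1F → g }} (base [ (λ _ → refl) ]) λ { 0F → f-gen ; 1F → g-gen }

suc-gen : {f : Op (suc n)} → Generated f → Generated λ v → suc (f v)
suc-gen = h-gen (constant 0)

run-gen : {f : Op (suc n)} → Generated f → Generated λ v → π₂ (fold (π₁ (f v)) step (π₂ (f v)))
run-gen = h-gen (constant 2)

pair-gen : {f g : Op (suc n)} → Generated f → Generated g → Generated λ v → pair (f v) (g v)
pair-gen f-gen = h-gen (suc-gen (suc-gen (suc-gen f-gen)))

tower-gen : {f : Op (suc n)} (k : ℕ) → Generated f → Generated λ v → tower k (f v)
tower-gen zero    f-gen = f-gen
tower-gen (suc k) f-gen = h-gen (constant 1) (tower-gen k f-gen)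

enc-gen : (gs : Fin m → Op (suc n)) → (∀ i → Generated (gs i)) → Generated λ v → enc (tabulate λ i → gs i v)
enc-gen {zero}  gs gs-gen = constant 0
enc-gen {suc m} gs gs-gen = respects
  (λ v → sym (enc-tabulate λ i → gs i v))
  (pair-gen (enc-gen (gs ∘ inject₁) (gs-gen ∘ inject₁)) (gs-gen (fromℕ m)))

-- The program is a constant, the start state arises by pairing, and a tower over the code of the
-- arguments supplies a sufficient number of steps.
computable⇒generated : {f : Op (suc n)} → Computable f → Generated f
computable⇒generated {f = f} C = respects result
  (run-gen (pair-gen (pair-gen (constant (program C ▸ 0)) input) (tower-gen height input)))
  where
  height = proj₁ (time-≼ C)
  input : Generated enc
  input = respects (λ v → cong enc (tabulate∘lookup v)) (enc-gen (λ i v → lookup v i) projection)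
  result : ∀ v → π₂ (fold (π₁ (pair (state (program C ▸ 0) (enc v)) (tower height (enc v)))) step
                          (π₂ (pair (state (program C ▸ 0) (enc v)) (tower height (enc v))))) ≡ f v
  result v = begin
    π₂ (fold (π₁ (pair s t)) step (π₂ (pair s t))) ≡⟨ cong₂ (λ p q → π₂ (fold p step q)) (π₁-pair s t) (π₂-pair s t) ⟩
    -- The tower is split into the true running time and a surplus, which is spent in the halted
    -- state.
    π₂ (fold s step t)                             ≡⟨ cong (λ t → π₂ (fold s step t)) (m∸n+n≡m (proj₂ (time-≼ C) v)) ⟨
    π₂ (fold s step (t ∸ time C v + time C v))     ≡⟨ cong π₂ (fold≡ (⟶-trans (runs C v 0) (halted (f v) (t ∸ time C v)))) ⟩
    π₂ (state 0 (f v))                             ≡⟨ π₂-pair 0 (f v) ⟩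
    f v                                            ∎
    where
    open ≡-Reasoning
    s = state (program C ▸ 0) (enc v)
    t = tower height (enc v)

theorem18 : Σ[ h ∈ Op 2 ] SubstitutionBasis ｛ h ｝ KalmarElementary
theorem18 = h , λ f → mk⇔ generated⇒elementary (computable⇒generated ∘ elementary⇒computable)
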